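{- Let $G=(V,E)$ be a finite undirected simple graph (no multiple edges between two vertices) whose cycles are pairwise edge-disjoint, with edge weights $w:E\to[0,1]$. Let $m$ be the maximum, over all vertices $v\in V$, of the minimum number of unit-sized bins needed to pack the weights of all edges incident to $v$. Then $G$ has a proper weighted edge coloring using $m+1$ colors.
   Context: An edge coloring of an edge-weighted graph is a proper weighted coloring if, for every vertex $v$ and every color $c$, the sum of the weights of the edges incident to $v$ colored $c$ is at most $1$. A minimum packing into unit-sized bins partitions the items into the fewest groups each of total weight at most $1$. This is the offline setting: the whole graph with its weights is given in advance. "Edge-disjoint cycles" means that no edge lies on two different cycles of $G$. -}

module Defs where

open import Data.Nat as ℕ using (ℕ)
import Data.Nat.Properties as ℕ
open import Data.Fin as Fin using (Fin)
import Data.Fin.Properties as Fin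
open import Data.Rational as ℚ using (ℚ; 0ℚ; 1ℚ; ½)
import Data.Rational.Properties as ℚ
import Data.Rational.Solver as ℚ
open import Data.List using (List; []; _∷_; length; map; foldr; filter; concat; allFin)
open import Data.List.Extrema.Nat using (max)
open import Data.List.Membership.Propositional using (_∈_)
open import Data.List.Relation.Unary.All using (All)
open import Data.List.Relation.Unary.Unique.Propositional using (Unique)
open import Data.List.Relation.Binary.Permutation.Propositional using (_↭_)
open import Data.Product using (∃-syntax; _×_; _,_; proj₁; proj₂)
open import Data.Sum using (_⊎_)
open import Function.Bundles using (_⇔_)
open import Relation.Nullary using (Dec)
open import Relation.Nullary.Decidable using (_⊎-dec_)
open import Relation.Binary.PropositionalEquality
  using (_≡_; refl; sym; trans; cong; subst)

-- Real numbers, represented by Cauchy sequences of rationals.  Two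
-- sequences x, y represent the same real number iff x ≤ℝ y and y ≤ℝ x.

IsCauchy : (ℕ → ℚ) → Set
IsCauchy x = ∀ ε → 0ℚ ℚ.< ε →
  ∃[ N ] (∀ i j → N ℕ.≤ i → N ℕ.≤ j → ℚ.∣ x i ℚ.- x j ∣ ℚ.< ε)

record ℝ : Set where
  constructor mkℝ
  field
    seq    : ℕ → ℚ
    cauchy : IsCauchy seq

open ℝ public

infix  4 _≤ℝ_
infixl 6 _+ℝ_

_≤ℝ_ : ℝ → ℝ → Set
x ≤ℝ y = ∀ ε → 0ℚ ℚ.< ε →
  ∃[ N ] (∀ i → N ℕ.≤ i → seq x i ℚ.≤ seq y i ℚ.+ ε)

fromℚ : ℚ → ℝ
fromℚ q = mkℝ (λ _ → q) λ ε 0<ε →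
  0 , λ _ _ _ _ → subst (λ p → ℚ.∣ p ∣ ℚ.< ε) (sym (ℚ.+-inverseʳ q)) 0<ε

0ℝ 1ℝ : ℝ
0ℝ = fromℚ 0ℚ
1ℝ = fromℚ 1ℚ

0<½* : ∀ {ε} → 0ℚ ℚ.< ε → 0ℚ ℚ.< ½ ℚ.* ε
0<½* {ε} 0<ε = subst (ℚ._< ½ ℚ.* ε) (ℚ.*-zeroʳ ½) (ℚ.*-monoʳ-<-pos ½ 0<ε)

½+½ : ∀ ε → ½ ℚ.* ε ℚ.+ ½ ℚ.* ε ≡ ε
½+½ ε = trans (sym (ℚ.*-distribʳ-+ ε ½ ½)) (ℚ.*-identityˡ ε)

+-cauchy : ∀ x y → IsCauchy x → IsCauchy y → IsCauchy (λ i → x i ℚ.+ y i)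
+-cauchy x y cx cy ε 0<ε
  with cx (½ ℚ.* ε) (0<½* 0<ε) | cy (½ ℚ.* ε) (0<½* 0<ε)
... | M , closeₓ | N , closeᵧ = M ℕ.⊔ N , λ i j M⊔N≤i M⊔N≤j → begin-strict
  ℚ.∣ (x i ℚ.+ y i) ℚ.- (x j ℚ.+ y j) ∣
    ≡⟨ cong ℚ.∣_∣ (rearrange (x i) (y i) (x j) (y j)) ⟩
  ℚ.∣ (x i ℚ.- x j) ℚ.+ (y i ℚ.- y j) ∣
    ≤⟨ ℚ.∣p+q∣≤∣p∣+∣q∣ (x i ℚ.- x j) (y i ℚ.- y j) ⟩
  ℚ.∣ x i ℚ.- x j ∣ ℚ.+ ℚ.∣ y i ℚ.- y j ∣
    <⟨ ℚ.+-mono-<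
         (closeₓ i j (ℕ.m⊔n≤o⇒m≤o M N M⊔N≤i) (ℕ.m⊔n≤o⇒m≤o M N M⊔N≤j))
         (closeᵧ i j (ℕ.m⊔n≤o⇒n≤o M N M⊔N≤i) (ℕ.m⊔n≤o⇒n≤o M N M⊔N≤j)) ⟩
  ½ ℚ.* ε ℚ.+ ½ ℚ.* ε
    ≡⟨ ½+½ ε ⟩
  ε ∎
  where
  open ℚ.≤-Reasoning
  open ℚ.+-*-Solver
  rearrange : ∀ a b c d →
    (a ℚ.+ b) ℚ.- (c ℚ.+ d) ≡ (a ℚ.- c) ℚ.+ (b ℚ.- d)
  rearrange = solve 4 (λ a b c d →
    (a :+ b) :- (c :+ d) := (a :- c) :+ (b :- d)) refl

_+ℝ_ : ℝ → ℝ → ℝ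
x +ℝ y = mkℝ (λ i → seq x i ℚ.+ seq y i) (+-cauchy (seq x) (seq y) (cauchy x) (cauchy y))

sumℝ : List ℝ → ℝ
sumℝ = foldr _+ℝ_ 0ℝ

-- Finite undirected simple graphs.  Each edge is stored once, with its
-- smaller endpoint first: this normal form of an unordered pair excludes
-- loops, and injectivity of `ends` excludes multiple edges.

record Graph : Set where
  field
    ∣V∣ ∣E∣        : ℕ
    ends           : Fin ∣E∣ → Fin ∣V∣ × Fin ∣V∣
    ends-ordered   : ∀ e → proj₁ (ends e) Fin.< proj₂ (ends e)
    ends-injective : ∀ {e f} → ends e ≡ ends f → e ≡ f

  Vertex Edge : Set
  Vertex = Fin ∣V∣
  Edge   = Fin ∣E∣

  Joins : Edge → Vertex → Vertex → Set
  Joins e u v = ends e ≡ (u , v) ⊎ ends e ≡ (v , u)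

  Incident : Vertex → Edge → Set
  Incident v e = v ≡ proj₁ (ends e) ⊎ v ≡ proj₂ (ends e)

  incident? : ∀ v e → Dec (Incident v e)
  incident? v e = (v Fin.≟ proj₁ (ends e)) ⊎-dec (v Fin.≟ proj₂ (ends e))

  incidentEdges : Vertex → List Edge
  incidentEdges v = filter (incident? v) (allFin ∣E∣)

  data Walk : Vertex → Vertex → Set where
    nil  : ∀ {u} → Walk u u
    step : ∀ {u v t} (e : Edge) → Joins e u v → Walk v t → Walk u t

  edges : ∀ {u v} → Walk u v → List Edge
  edges nil          = []
  edges (step e _ p) = e ∷ edges p

  -- All vertices visited except the final one, so that the base vertex of
  -- a closed walk is listed once.
  sources : ∀ {u v} → Walk u v → List Vertex
  sources nil              = []
  sources (step {u} _ _ p) = u ∷ sources p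

  record Cycle : Set where
    field
      {base}   : Vertex
      walk     : Walk base base
      distinct : Unique (sources walk)
      length≥3 : 3 ℕ.≤ length (edges walk)

  _∈ᶜ_ : Edge → Cycle → Set
  e ∈ᶜ C = e ∈ edges (Cycle.walk C)

  -- A cycle is a subgraph: base vertex and orientation are forgotten.
  SameCycle : Cycle → Cycle → Set
  SameCycle C D = ∀ e → (e ∈ᶜ C) ⇔ (e ∈ᶜ D)

  EdgeDisjointCycles : Set
  EdgeDisjointCycles = ∀ C D e → e ∈ᶜ C → e ∈ᶜ D → SameCycle C D

open Graph public

weight : {A : Set} → (A → ℝ) → List A → ℝ
weight w xs = sumℝ (map w xs)

IsPacking : {A : Set} → (A → ℝ) → List A → List (List A) → Set
IsPacking w items bins =
  (concat bins ↭ items) × All (λ bin → weight w bin ≤ℝ 1ℝ) bins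

-- A relation rather than a function, since _≤ℝ_ is not decidable.
IsMinBins : {A : Set} → (A → ℝ) → List A → ℕ → Set
IsMinBins w items k =
  (∃[ bins ] (IsPacking w items bins × length bins ≡ k)) ×
  (∀ bins → IsPacking w items bins → k ℕ.≤ length bins)

-- The maximum over an empty index set is 0.
maximum : ∀ {n} → (Fin n → ℕ) → ℕ
maximum {n} b = max 0 (map b (allFin n))

colorClass : (G : Graph) → ∀ {k} → (Edge G → Fin k) → Vertex G → Fin k → List (Edge G)
colorClass G color v c = filter (λ e → color e Fin.≟ c) (incidentEdges G v)

IsProperWeightedColoring : (G : Graph) → (Edge G → ℝ) → ∀ {k} → (Edge G → Fin k) → Set
IsProperWeightedColoring G w color =
  ∀ v c → weight w (colorClass G color v c) ≤ℝ 1ℝ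

{-# OPTIONS --safe #-}

-- For m ≤ 1 one colour suffices.  For m ≥ 2, fix at every vertex a packing of its edges into m
-- bins and look for a colouring together with, at each vertex, a surjection from the m + 1
-- colours onto the m bins that sends the colour of every incident edge to the bin of that edge;
-- each colour class is then contained in a bin.  The set S of finished vertices grows so that
-- each component outside S stays attached to S at no more than one vertex.  If a component
-- hangs on S by a single edge e = uv, colour e as u demands and choose the surjection of v
-- accordingly.  Otherwise two edges from u reach the component and close a cycle through u; its
-- other edges are coloured so that consecutive edges differ at every vertex but u, which
-- three colours allow, and at a vertex whose two cycle edges have different colours the
-- surjection can be prescribed on both.  A chord or an ear on that cycle would produce a second
-- cycle sharing an edge with it, so no further edges appear and the invariant persists.
module Submission where

open import Data.Nat as ℕ using (ℕ; zero; suc; _+_; s≤s; z≤n)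
import Data.Nat.Properties as ℕ
open import Data.Fin as Fin using (Fin; zero; suc)
import Data.Fin.Properties as Fin
open import Data.Fin.Permutation.Components using (transpose; transpose-inverse)
open import Data.Fin.Subset using (Subset; ⁅_⁆; _∪_; _⊃_)
  renaming (_∈_ to _∈ˢ_; _∉_ to _∉ˢ_; _⊆_ to _⊆ˢ_; ⊥ to ∅)
open import Data.Fin.Subset.Properties
  using (_∈?_; ∉⊥; x∈⁅x⁆; x∈⁅y⁆⇒x≡y; x∈p∪q⁺; x∈p∪q⁻; q⊆p∪q)
open import Data.Fin.Subset.Induction using (⊃-wellFounded; Acc; acc)
open import Data.Rational as ℚ using (ℚ; 0ℚ; 1ℚ; ½)
import Data.Rational.Properties as ℚ
open import Data.Rational.Solver using (module +-*-Solver)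
open import Data.List using (List; []; _∷_; _++_; [_]; length; foldr; allFin)
open import Data.Vec.Functional using (updateAt)
open import Data.Vec.Functional.Properties using (updateAt-updates; updateAt-minimal)
open import Data.List.Membership.Propositional using (_∈_; _∉_)
open import Data.List.Membership.Propositional.Properties
  using (∈-++⁺ˡ; ∈-++⁺ʳ; ∈-++⁻; ∈-∃++; ∈-concat⁻; ∈-filter⁺; ∈-filter⁻; ∈-allFin; ∈-map⁺)
import Data.List.Membership.DecPropositional as Dec∈
open import Data.List.Relation.Binary.Permutation.Propositional
  using (_↭_; refl; prep; swap; trans; ↭-sym)
open import Data.List.Relation.Binary.Permutation.Propositional.Properties
  using (shift; ∈-resp-↭)
open import Data.List.Relation.Unary.All as All using (All; []; _∷_)
import Data.List.Relation.Unary.All.Properties as All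
open import Data.List.Relation.Unary.AllPairs using ([]; _∷_)
open import Data.List.Relation.Unary.Any using (Any; here; there)
open import Data.List.Relation.Unary.Unique.Propositional using (Unique)
import Data.List.Relation.Unary.Unique.Propositional.Properties as Unique
open import Data.List.Extrema ℕ.≤-totalOrder using (xs≤max)
open import Data.Product using (Σ-syntax; ∃-syntax; _×_; _,_; proj₁; proj₂)
open import Data.Product.Properties using (≡-dec)
open import Data.Sum using (_⊎_; inj₁; inj₂; [_,_]′)
open import Data.Empty using (⊥; ⊥-elim)
open import Function using (_∘_; const; case_of_; Equivalence)
open import Relation.Nullary using (¬_; Dec; yes; no; ¬?; contradiction)
open import Relation.Nullary.Decidable using (_×-dec_; _⊎-dec_; map′; decidable-stable; from-yes)
open import Relation.Binary.PropositionalEquality as ≡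
  using (_≡_; _≢_; refl; sym; cong; cong₂; subst; module ≡-Reasoning)
open import Defs using (Graph; ℝ; seq; _≤ℝ_; 0ℝ; 1ℝ; 0<½*; ½+½; weight; maximum;
  IsMinBins)

-- Weights

-- The Cauchy proofs play no role in _≤ℝ_, so inequalities are handled on bare sequences,
-- where the type checker never has to compare the large Cauchy proofs of sums.
infix 4 _≲_
_≲_ : (ℕ → ℚ) → (ℕ → ℚ) → Set
x ≲ y = ∀ ε → 0ℚ ℚ.< ε → ∃[ N ] (∀ i → N ℕ.≤ i → x i ℚ.≤ y i ℚ.+ ε)

≤⇒≲ : ∀ {x y} → (∀ i → x i ℚ.≤ y i) → x ≲ y
≤⇒≲ {x} {y} x≤y ε 0<ε = 0 , λ i _ → begin
  x i            ≤⟨ x≤y i ⟩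
  y i            ≡⟨ ℚ.+-identityʳ (y i) ⟨
  y i ℚ.+ 0ℚ     ≤⟨ ℚ.+-monoʳ-≤ (y i) (ℚ.<⇒≤ 0<ε) ⟩
  y i ℚ.+ ε      ∎
  where open ℚ.≤-Reasoning

0≲1 : (λ _ → 0ℚ) ≲ (λ _ → 1ℚ)
0≲1 = ≤⇒≲ λ _ → from-yes (0ℚ ℚ.≤? 1ℚ)

≲-trans : ∀ {x y z} → x ≲ y → y ≲ z → x ≲ z
≲-trans {x} {y} {z} x≲y y≲z ε 0<ε
  with x≲y (½ ℚ.* ε) (0<½* 0<ε) | y≲z (½ ℚ.* ε) (0<½* 0<ε)
... | M , x≤y | N , y≤z = M ℕ.⊔ N , λ i M⊔N≤i → begin
  x i                              ≤⟨ x≤y i (ℕ.m⊔n≤o⇒m≤o M N M⊔N≤i) ⟩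
  y i ℚ.+ ½ ℚ.* ε                  ≤⟨ ℚ.+-monoˡ-≤ (½ ℚ.* ε) (y≤z i (ℕ.m⊔n≤o⇒n≤o M N M⊔N≤i)) ⟩
  z i ℚ.+ ½ ℚ.* ε ℚ.+ ½ ℚ.* ε      ≡⟨ ℚ.+-assoc (z i) (½ ℚ.* ε) (½ ℚ.* ε) ⟩
  z i ℚ.+ (½ ℚ.* ε ℚ.+ ½ ℚ.* ε)    ≡⟨ cong (z i ℚ.+_) (½+½ ε) ⟩
  z i ℚ.+ ε                        ∎
  where open ℚ.≤-Reasoning

+-mono-≲ : ∀ {x y u v} → x ≲ y → u ≲ v → (λ i → x i ℚ.+ u i) ≲ (λ i → y i ℚ.+ v i)
+-mono-≲ {x} {y} {u} {v} x≲y u≲v ε 0<ε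
  with x≲y (½ ℚ.* ε) (0<½* 0<ε) | u≲v (½ ℚ.* ε) (0<½* 0<ε)
... | M , x≤y | N , u≤v = M ℕ.⊔ N , λ i M⊔N≤i → begin
  x i ℚ.+ u i
    ≤⟨ ℚ.+-mono-≤ (x≤y i (ℕ.m⊔n≤o⇒m≤o M N M⊔N≤i)) (u≤v i (ℕ.m⊔n≤o⇒n≤o M N M⊔N≤i)) ⟩
  (y i ℚ.+ ½ ℚ.* ε) ℚ.+ (v i ℚ.+ ½ ℚ.* ε)
    ≡⟨ interchange (y i) (½ ℚ.* ε) (v i) ⟩
  (y i ℚ.+ v i) ℚ.+ (½ ℚ.* ε ℚ.+ ½ ℚ.* ε)
    ≡⟨ cong (y i ℚ.+ v i ℚ.+_) (½+½ ε) ⟩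
  y i ℚ.+ v i ℚ.+ ε ∎
  where
  open ℚ.≤-Reasoning
  open +-*-Solver
  interchange : ∀ a b c → (a ℚ.+ b) ℚ.+ (c ℚ.+ b) ≡ (a ℚ.+ c) ℚ.+ (b ℚ.+ b)
  interchange = solve 3 (λ a b c → (a :+ b) :+ (c :+ b) := (a :+ c) :+ (b :+ b)) refl

module _ {A : Set} (w : A → ℝ) where

  weightSeq : List A → ℕ → ℚ
  weightSeq []       i = 0ℚ
  weightSeq (x ∷ xs) i = seq (w x) i ℚ.+ weightSeq xs i

  seq-weight : ∀ xs i → seq (weight w xs) i ≡ weightSeq xs i
  seq-weight []       i = refl
  seq-weight (x ∷ xs) i = cong (seq (w x) i ℚ.+_) (seq-weight xs i)

  weightSeq-↭ : ∀ {xs ys} → xs ↭ ys → ∀ i → weightSeq xs i ≡ weightSeq ys i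
  weightSeq-↭ refl i = refl
  weightSeq-↭ (prep x p) i = cong (seq (w x) i ℚ.+_) (weightSeq-↭ p i)
  weightSeq-↭ {x ∷ y ∷ xs} {_ ∷ _ ∷ ys} (swap x y p) i = begin
    a ℚ.+ (b ℚ.+ weightSeq xs i)   ≡⟨ ℚ.+-assoc a b _ ⟨
    (a ℚ.+ b) ℚ.+ weightSeq xs i   ≡⟨ cong₂ ℚ._+_ (ℚ.+-comm a b) (weightSeq-↭ p i) ⟩
    (b ℚ.+ a) ℚ.+ weightSeq ys i   ≡⟨ ℚ.+-assoc b a _ ⟩
    b ℚ.+ (a ℚ.+ weightSeq ys i)   ∎
    where
    open ≡-Reasoning
    a = seq (w x) i
    b = seq (w y) i
  weightSeq-↭ (trans p q) i = ≡.trans (weightSeq-↭ p i) (weightSeq-↭ q i)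

  module _ (0≤w : ∀ x → 0ℝ ≤ℝ w x) where

    weightSeq-nonNegative : ∀ xs → (λ _ → 0ℚ) ≲ weightSeq xs
    weightSeq-nonNegative []       = ≤⇒≲ λ _ → ℚ.≤-refl
    weightSeq-nonNegative (x ∷ xs) =
      +-mono-≲ {_} {seq (w x)} {_} {weightSeq xs} (0≤w x) (weightSeq-nonNegative xs)

    -- Each head of `xs` is located in `ys`, moved to the front and cancelled. Since `xs` has no
    -- repetitions, its tail still lies in what remains of `ys`, and the leftover items at the end
    -- have nonnegative weight.
    weightSeq-mono-⊆ : ∀ {xs} ys → Unique xs → (∀ {x} → x ∈ xs → x ∈ ys) →
      weightSeq xs ≲ weightSeq ys
    weightSeq-mono-⊆ {[]}     ys _ _ = weightSeq-nonNegative ys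
    weightSeq-mono-⊆ {x ∷ xs} ys u@(_ ∷ uniq) xs⊆ys
      with as , bs , refl ← ∈-∃++ (xs⊆ys (here refl)) =
      ≲-trans {_} {weightSeq (x ∷ as ++ bs)} {weightSeq ys}
        (+-mono-≲ {seq (w x)} {seq (w x)} {weightSeq xs} {weightSeq (as ++ bs)}
          (≤⇒≲ λ _ → ℚ.≤-refl) (weightSeq-mono-⊆ (as ++ bs) uniq xs⊆rest))
        (≤⇒≲ λ i → ℚ.≤-reflexive (weightSeq-↭ (↭-sym (shift x as bs)) i))
      where
      xs⊆rest : ∀ {z} → z ∈ xs → z ∈ as ++ bs
      xs⊆rest z∈xs with ∈-resp-↭ (shift x as bs) (xs⊆ys (there z∈xs))
      ... | here refl = contradiction z∈xs (Unique.Unique[x∷xs]⇒x∉xs u)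
      ... | there z∈  = z∈

    weight≤1-⊆ : ∀ {xs ys} → Unique xs → (∀ {x} → x ∈ xs → x ∈ ys) →
      weight w ys ≤ℝ 1ℝ → weight w xs ≤ℝ 1ℝ
    weight≤1-⊆ {xs} {ys} uniq xs⊆ys ys≤1 =
      ≲-trans {_} {weightSeq xs} {seq 1ℝ} (≤⇒≲ λ i → ℚ.≤-reflexive (seq-weight xs i))
        (≲-trans {_} {weightSeq ys} {seq 1ℝ} (weightSeq-mono-⊆ ys uniq xs⊆ys)
          (≲-trans {_} {seq (weight w ys)} {seq 1ℝ}
            (≤⇒≲ λ i → ℚ.≤-reflexive (sym (seq-weight ys i))) ys≤1))

-- Surjections from colours onto bins

-- Sends a to i and the j-th colour other than a to j, after the swap that moves c to k.
prescribedSurjection : ∀ {n} {a c : Fin (suc n)} → a ≢ c → (i k : Fin n) →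
  Σ[ χ ∈ (Fin (suc n) → Fin n) ] (∀ j → ∃[ d ] χ d ≡ j) × χ a ≡ i × χ c ≡ k
prescribedSurjection {n} {a} {c} a≢c i k = χ , onto , χa , χc
  where
  χ : Fin (suc n) → Fin n
  χ d with a Fin.≟ d
  ... | yes _  = i
  ... | no a≢d = transpose (Fin.punchOut a≢c) k (Fin.punchOut a≢d)

  χ-punchIn : ∀ j → χ (Fin.punchIn a j) ≡ transpose (Fin.punchOut a≢c) k j
  χ-punchIn j with a Fin.≟ Fin.punchIn a j
  ... | yes eq = contradiction (sym eq) (Fin.punchInᵢ≢i a j)
  ... | no a≢  = cong (transpose _ k)
                   (≡.trans (Fin.punchOut-cong a refl) (Fin.punchOut-punchIn a {j}))

  onto : ∀ j → ∃[ d ] χ d ≡ j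
  -- The colours other than `a` already reach every bin, which is why `i` can be arbitrary; the
  -- preimage undoes the swap and then skips `a`.
  onto j = Fin.punchIn a (transpose k (Fin.punchOut a≢c) j) ,
    ≡.trans (χ-punchIn _) (transpose-inverse (Fin.punchOut a≢c) k)

  χa : χ a ≡ i
  χa with a Fin.≟ a
  ... | yes _  = refl
  ... | no a≢a = contradiction refl a≢a

  transpose-source : ∀ (j : Fin n) → transpose j k j ≡ k
  transpose-source j with j Fin.≟ j
  ... | yes _  = refl
  ... | no j≢j = contradiction refl j≢j

  χc : χ c ≡ k
  χc with a Fin.≟ c
  ... | yes a≡c = contradiction a≡c a≢c
  ... | no a≢c′ = ≡.trans
    (cong (transpose _ k) (Fin.punchOut-cong a {i≢j = a≢c′} {i≢k = a≢c} refl))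
    (transpose-source (Fin.punchOut a≢c))

different : ∀ {n} (a : Fin (2 + n)) → ∃[ t ] a ≢ t
different a = Fin.punchIn a zero , Fin.punchInᵢ≢i a zero ∘ sym

-- For distinct `a` and `c`, delete `a` and avoid the image of `c` among the remaining colours, of
-- which there are at least two.
differentFromBoth : ∀ {n} (a c : Fin (3 + n)) → ∃[ t ] a ≢ t × t ≢ c
differentFromBoth a c with a Fin.≟ c
... | yes refl = let t , a≢t = different a in t , a≢t , a≢t ∘ sym
... | no a≢c   = let t , c≢t = different (Fin.punchOut a≢c) in
  Fin.punchIn a t , Fin.punchInᵢ≢i a t ∘ sym ,
  λ eq → c≢t (Fin.punchIn-injective a _ _ (≡.trans (Fin.punchIn-punchOut a≢c) (sym eq)))

-- Lists without repetition

module _ {A : Set} where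

  Unique-++⁻ : ∀ xs {ys : List A} → Unique (xs ++ ys) →
    Unique xs × Unique ys × (∀ {z} → z ∈ xs → z ∉ ys)
  Unique-++⁻ []       u = [] , u , λ ()
  Unique-++⁻ (x ∷ xs) u@(x∉ ∷ uniq) with Unique-++⁻ xs uniq
  ... | uxs , uys , disjoint = All.++⁻ˡ xs x∉ ∷ uxs , uys , λ where
    (here refl) → Unique.Unique[x∷xs]⇒x∉xs u ∘ ∈-++⁺ʳ xs
    (there z∈)  → disjoint z∈

  -- The list form of a detour on a cycle: the arc `ys` gives way to its start `a` followed by the
  -- new vertices `es`.
  Unique-replace : ∀ {xs ys zs es : List A} {a} → Unique (xs ++ ys ++ zs) → a ∈ ys →
    Unique es → (∀ {z} → z ∈ es → z ∉ xs ++ ys ++ zs) → Unique (xs ++ (a ∷ es) ++ zs)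
  Unique-replace {xs} {ys} {zs} {es} {a} uniq a∈ys ues fresh
    with uxs , uyzs , xs∩yzs ← Unique-++⁻ xs uniq
    with _ , uzs , ys∩zs ← Unique-++⁻ ys uyzs =
    Unique.++⁺ uxs (Unique.++⁺ (a∉es ∷ ues) uzs aes∩zs) xs∩aeszs
    where
    a∉es : All (a ≢_) es
    a∉es = All.tabulate λ { e∈es refl → fresh e∈es (∈-++⁺ʳ xs (∈-++⁺ˡ a∈ys)) }
    aes∩zs : ∀ {z} → ¬ (z ∈ a ∷ es × z ∈ zs)
    aes∩zs (here refl , z∈zs) = ys∩zs a∈ys z∈zs
    aes∩zs (there z∈es , z∈zs) = fresh z∈es (∈-++⁺ʳ xs (∈-++⁺ʳ ys z∈zs))
    xs∩aeszs : ∀ {z} → ¬ (z ∈ xs × z ∈ (a ∷ es) ++ zs)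
    xs∩aeszs (z∈xs , z∈) with ∈-++⁻ (a ∷ es) z∈
    ... | inj₁ (here refl)  = xs∩yzs z∈xs (∈-++⁺ˡ a∈ys)
    ... | inj₁ (there z∈es) = fresh z∈es (∈-++⁺ˡ z∈xs)
    ... | inj₂ z∈zs         = xs∩yzs z∈xs (∈-++⁺ʳ ys z∈zs)

-- Walks and cycles

module Walks (G : Graph) where
  open Graph G

  Joins-sym : ∀ {e u v} → Joins e u v → Joins e v u
  Joins-sym (inj₁ eq) = inj₂ eq
  Joins-sym (inj₂ eq) = inj₁ eq

  Joins? : ∀ e u v → Dec (Joins e u v)
  Joins? e u v = ≡-dec Fin._≟_ Fin._≟_ (ends e) (u , v) ⊎-dec ≡-dec Fin._≟_ Fin._≟_ (ends e) (v , u)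

  Joins⇒≢ : ∀ {e u v} → Joins e u v → u ≢ v
  Joins⇒≢ {e} (inj₁ eq) refl with ends e | ends-ordered e
  Joins⇒≢ {e} (inj₁ refl) refl | _ | u<u = Fin.<-irrefl refl u<u
  Joins⇒≢ {e} (inj₂ eq) refl with ends e | ends-ordered e
  Joins⇒≢ {e} (inj₂ refl) refl | _ | u<u = Fin.<-irrefl refl u<u

  Joins-endpoints : ∀ {e u v u′ v′} → Joins e u v → Joins e u′ v′ →
    (u ≡ u′ × v ≡ v′) ⊎ (u ≡ v′ × v ≡ u′)
  Joins-endpoints (inj₁ p) (inj₁ q) with refl ← ≡.trans (sym p) q = inj₁ (refl , refl)
  Joins-endpoints (inj₁ p) (inj₂ q) with refl ← ≡.trans (sym p) q = inj₂ (refl , refl)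
  Joins-endpoints (inj₂ p) (inj₁ q) with refl ← ≡.trans (sym p) q = inj₂ (refl , refl)
  Joins-endpoints (inj₂ p) (inj₂ q) with refl ← ≡.trans (sym p) q = inj₁ (refl , refl)

  -- `ends-ordered` excludes that one pair is stored in two opposite orders, so the stored pairs
  -- agree and `ends-injective` applies.
  Joins-unique : ∀ {e f u v} → Joins e u v → Joins f u v → e ≡ f
  Joins-unique {e} {f} p q = ends-injective (same p q)
    where
    crossed : ∀ {e f u v} → ends e ≡ (u , v) → ends f ≡ (v , u) → ⊥
    crossed {e} {f} p q = Fin.<-asym
      (subst (λ z → proj₁ z Fin.< proj₂ z) p (ends-ordered e))
      (subst (λ z → proj₁ z Fin.< proj₂ z) q (ends-ordered f))
    same : ∀ {u v} → Joins e u v → Joins f u v → ends e ≡ ends f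
    same (inj₁ p) (inj₁ q) = ≡.trans p (sym q)
    same (inj₁ p) (inj₂ q) = ⊥-elim (crossed {e} {f} p q)
    same (inj₂ p) (inj₁ q) = ⊥-elim (crossed {f} {e} q p)
    same (inj₂ p) (inj₂ q) = ≡.trans p (sym q)

  infixr 5 _·_
  _·_ : ∀ {x y z} → Walk x y → Walk y z → Walk x z
  nil        · q = q
  step e j p · q = step e j (p · q)

  ·-assoc : ∀ {x y z t} (p : Walk x y) (q : Walk y z) (r : Walk z t) → (p · q) · r ≡ p · (q · r)
  ·-assoc nil          q r = refl
  ·-assoc (step e j p) q r = cong (step e j) (·-assoc p q r)

  edges-· : ∀ {x y z} (p : Walk x y) (q : Walk y z) → edges (p · q) ≡ edges p ++ edges q
  edges-· nil          q = refl
  edges-· (step e j p) q = cong (e ∷_) (edges-· p q)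

  sources-· : ∀ {x y z} (p : Walk x y) (q : Walk y z) → sources (p · q) ≡ sources p ++ sources q
  sources-· nil              q = refl
  sources-· (step {u} e j p) q = cong (u ∷_) (sources-· p q)

  vertices : ∀ {x y} → Walk x y → List Vertex
  vertices {x} nil          = x ∷ []
  vertices {x} (step _ _ p) = x ∷ vertices p

  source∈vertices : ∀ {x y} (p : Walk x y) → x ∈ vertices p
  source∈vertices nil          = here refl
  source∈vertices (step _ _ _) = here refl

  target∈vertices : ∀ {x y} (p : Walk x y) → y ∈ vertices p
  target∈vertices nil          = here refl
  target∈vertices (step _ _ p) = there (target∈vertices p)

  source∈sources : ∀ {x y} (p : Walk x y) → x ≢ y → x ∈ sources p
  source∈sources nil          x≢x = contradiction refl x≢x
  source∈sources (step _ _ _) _   = here refl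

  -- Passes from paths, whose simplicity is stated with `vertices`, to cycles, whose simplicity is
  -- stated with `sources`.
  sources-snoc : ∀ {x y z f} (p : Walk x y) (j : Joins f y z) →
    sources (p · step f j nil) ≡ vertices p
  sources-snoc nil              j = refl
  sources-snoc (step {u} _ _ p) j = cong (u ∷_) (sources-snoc p j)

  edge-endpoint : ∀ {x y e u v} (p : Walk x y) → e ∈ edges p → Joins e u v → u ∈ vertices p
  edge-endpoint (step _ j p) (here refl) k with Joins-endpoints k j
  ... | inj₁ (refl , _) = here refl
  ... | inj₂ (refl , _) = there (source∈vertices p)
  edge-endpoint (step _ j p) (there e∈p) k = there (edge-endpoint p e∈p k)

  reverseOnto : ∀ {x y z} → Walk x y → Walk x z → Walk y z
  reverseOnto nil          q = q
  reverseOnto (step e j p) q = reverseOnto p (step e (Joins-sym j) q)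

  vertices-reverseOnto : ∀ {x y z u} (p : Walk x y) (q : Walk x z) →
    u ∈ vertices (reverseOnto p q) → u ∈ vertices p ⊎ u ∈ vertices q
  vertices-reverseOnto nil          q u∈ = inj₂ u∈
  vertices-reverseOnto (step e j p) q u∈ with vertices-reverseOnto p (step e (Joins-sym j) q) u∈
  ... | inj₁ u∈p         = inj₁ (there u∈p)
  ... | inj₂ (here refl) = inj₁ (there (source∈vertices p))
  ... | inj₂ (there u∈q) = inj₂ u∈q

  vertices-· : ∀ {x y z u} (p : Walk x y) (q : Walk y z) →
    u ∈ vertices (p · q) → u ∈ vertices p ⊎ u ∈ vertices q
  vertices-· nil          q u∈          = inj₂ u∈
  vertices-· (step _ _ p) q (here refl) = inj₁ (here refl)
  vertices-· (step _ _ p) q (there u∈) with vertices-· p q u∈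
  ... | inj₁ u∈p = inj₁ (there u∈p)
  ... | inj₂ u∈q = inj₂ u∈q

  splitAtVertex : ∀ {x y u} (p : Walk x y) → u ∈ vertices p →
    Σ[ q ∈ Walk x u ] Σ[ r ∈ Walk u y ]
      (∀ {t} → t ∈ vertices q → t ∈ vertices p) × (∀ {t} → t ∈ vertices r → t ∈ vertices p) ×
      (Unique (vertices p) → Unique (vertices r))
  splitAtVertex nil            (here refl) = nil , nil , (λ t∈ → t∈) , (λ t∈ → t∈) , λ u → u
  splitAtVertex p@(step _ _ _) (here refl) =
    nil , p , (λ { (here refl) → here refl }) , (λ t∈ → t∈) , λ u → u
  splitAtVertex (step e j p) (there u∈) with splitAtVertex p u∈
  ... | q , r , q⊆p , r⊆p , unique = step e j q , r ,
    (λ { (here refl) → here refl ; (there t∈) → there (q⊆p t∈) }) , there ∘ r⊆p ,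
    λ { (_ ∷ u) → unique u }

  splitAtSource : ∀ {x y u} (p : Walk x y) → u ∈ sources p →
    Σ[ q ∈ Walk x u ] Σ[ r ∈ Walk u y ] p ≡ q · r
  splitAtSource p@(step _ _ _) (here refl) = nil , p , refl
  splitAtSource (step e j p) (there u∈) with splitAtSource p u∈
  ... | q , r , refl = step e j q , r , refl

  _∈ⱽ?_ : ∀ (u : Vertex) us → Dec (u ∈ us)
  _∈ⱽ?_ = Dec∈._∈?_ Fin._≟_

  -- If `x` recurs on the loop-free remainder, everything before that occurrence is dropped;
  -- otherwise the first step can be kept.
  eraseLoops : ∀ {x y} (p : Walk x y) →
    Σ[ q ∈ Walk x y ] Unique (vertices q) × (∀ {t} → t ∈ vertices q → t ∈ vertices p)
  eraseLoops nil = nil , [] ∷ [] , λ t∈ → t∈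
  eraseLoops {x} (step e j p) with eraseLoops p
  ... | q , uq , q⊆p with x ∈ⱽ? vertices q
  ... | yes x∈q = let _ , r , _ , r⊆q , unique = splitAtVertex q x∈q in
    r , unique uq , there ∘ q⊆p ∘ r⊆q
  ... | no x∉q  = step e j q , All.tabulate (λ { t∈ refl → x∉q t∈ }) ∷ uq ,
    λ { (here refl) → here refl ; (there t∈) → there (q⊆p t∈) }

  -- Lying in the same component of the graph with `S` deleted; both ends must avoid `S` too.
  Linked : Subset ∣V∣ → Vertex → Vertex → Set
  Linked S x y = Σ[ p ∈ Walk x y ] (∀ {t} → t ∈ vertices p → t ∉ˢ S)

  Linked-refl : ∀ {S x} → x ∉ˢ S → Linked S x x
  Linked-refl x∉S = nil , λ { (here refl) → x∉S }

  Linked-sym : ∀ {S x y} → Linked S x y → Linked S y x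
  Linked-sym (p , out) = reverseOnto p nil , λ t∈ → case vertices-reverseOnto p nil t∈ of λ where
    (inj₁ t∈p)         → out t∈p
    (inj₂ (here refl)) → out (source∈vertices p)

  Linked-trans : ∀ {S x y z} → Linked S x y → Linked S y z → Linked S x z
  Linked-trans (p , outp) (q , outq) = p · q , [ outp , outq ]′ ∘ vertices-· p q

  Linked-edge : ∀ {S e x y} → Joins e x y → x ∉ˢ S → y ∉ˢ S → Linked S x y
  Linked-edge {e = e} j x∉S y∉S = step e j nil , λ where
    (here refl)         → x∉S
    (there (here refl)) → y∉S

  Linked-weaken : ∀ {S T x y} → S ⊆ˢ T → Linked T x y → Linked S x y
  Linked-weaken S⊆T (p , out) = p , λ t∈p → out t∈p ∘ S⊆T

  -- A simple path to another vertex leaves `x` by some edge and never returns, so its remainder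
  -- avoids `x` as well as `S`. The search therefore recurses with `x` added to the forbidden set.
  linked? : ∀ S → Acc _⊃_ S → ∀ x y → Dec (Linked S x y)
  linked? S (acc rec) x y with x ∈? S
  ... | yes x∈S = no λ (p , out) → out (source∈vertices p) x∈S
  ... | no x∉S with x Fin.≟ y
  ... | yes refl = yes (Linked-refl x∉S)
  ... | no x≢y = map′ extend shorten
    (Fin.any? λ e → Fin.any? λ z → Joins? e x z ×-dec linked? S+x (rec S⊂S+x) z y)
    where
    S+x : Subset ∣V∣
    S+x = ⁅ x ⁆ ∪ S
    S⊂S+x : S+x ⊃ S
    S⊂S+x = q⊆p∪q ⁅ x ⁆ S , x , x∈p∪q⁺ (inj₁ (x∈⁅x⁆ x)) , x∉S
    extend : (∃[ e ] ∃[ z ] (Joins e x z × Linked S+x z y)) → Linked S x y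
    extend (e , z , j , linked) with p , out ← Linked-weaken (proj₁ S⊂S+x) linked =
      step e j p , λ { (here refl) → x∉S ; (there t∈) → out t∈ }
    shorten : Linked S x y → ∃[ e ] ∃[ z ] (Joins e x z × Linked S+x z y)
    shorten (p , out) with eraseLoops p
    ... | nil        , _ , _ = contradiction refl x≢y
    ... | step e j q , u@(_ ∷ _) , q⊆p = e , _ , j , q , λ t∈q t∈S+x →
      case x∈p∪q⁻ ⁅ x ⁆ S t∈S+x of λ where
        (inj₁ t∈x) → Unique.Unique[x∷xs]⇒x∉xs u
                       (subst (_∈ vertices q) (x∈⁅y⁆⇒x≡y x t∈x) t∈q)
        (inj₂ t∈S) → out (q⊆p (there t∈q)) t∈S

  module _ (disjointCycles : EdgeDisjointCycles) where

    -- Replacing the arc q of the closed walk p · q · r by the detour through g gives a second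
    -- cycle, which shares the edges of p and r with the first but contains g.
    detour-impossible : ∀ {b a c x g} (p : Walk b a) (q : Walk a c) (r : Walk c b) →
      Unique (sources (p · q · r)) → 3 ℕ.≤ length (edges (p · q · r)) → a ≢ c →
      Joins g a x → g ∉ edges (p · q · r) → (d : Walk x c) → Unique (sources d) →
      (∀ {t} → t ∈ sources d → t ∉ sources (p · q · r)) → ⊥
    detour-impossible {b} {a} {c} {x} {g} p q r uniq long a≢c j g∉C d ud fresh =
      g∉C (Equivalence.from (disjointCycles C D (proj₁ common)
                              (proj₁ (proj₂ common)) (proj₂ (proj₂ common)) g) g∈D)
      where
      C D : Cycle
      newWalk : Walk b b
      newWalk = p · step g j (d · r)

      edges-new : edges newWalk ≡ edges p ++ g ∷ edges d ++ edges r
      edges-new = ≡.trans (edges-· p _) (cong (λ es → edges p ++ g ∷ es) (edges-· d r))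

      edges-old : edges (p · q · r) ≡ edges p ++ edges q ++ edges r
      edges-old = ≡.trans (edges-· p _) (cong (edges p ++_) (edges-· q r))

      sources-old : sources (p · q · r) ≡ sources p ++ sources q ++ sources r
      sources-old = ≡.trans (sources-· p _) (cong (sources p ++_) (sources-· q r))

      sources-new : sources newWalk ≡ sources p ++ (a ∷ sources d) ++ sources r
      sources-new = ≡.trans (sources-· p _) (cong (λ es → sources p ++ a ∷ es) (sources-· d r))

      new-unique : Unique (sources newWalk)
      new-unique = subst Unique (sym sources-new)
        (Unique-replace (subst Unique sources-old uniq) (source∈sources q a≢c) ud
          λ t∈d → fresh t∈d ∘ subst (_ ∈_) (sym sources-old))

      old∋p : ∀ {e} → e ∈ edges p → e ∈ edges (p · q · r)
      old∋p e∈p = subst (_ ∈_) (sym edges-old) (∈-++⁺ˡ e∈p)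

      old∋r : ∀ {e} → e ∈ edges r → e ∈ edges (p · q · r)
      old∋r e∈r = subst (_ ∈_) (sym edges-old) (∈-++⁺ʳ (edges p) (∈-++⁺ʳ (edges q) e∈r))

      g∈D : g ∈ edges newWalk
      g∈D = subst (g ∈_) (sym edges-new) (∈-++⁺ʳ (edges p) (here refl))

      -- `p` and `r` cannot both be empty, since then `a` and `c` would both be the base.
      common : ∃[ e ] (e ∈ edges (p · q · r) × e ∈ edges newWalk)
      common = build p r old∋p old∋r (λ e∈p → subst (_ ∈_) (sym edges-new) (∈-++⁺ˡ e∈p))
        λ e∈r → subst (_ ∈_) (sym edges-new) (∈-++⁺ʳ (edges p) (there (∈-++⁺ʳ (edges d) e∈r)))
        where
        build : ∀ {es fs} (p : Walk b a) (r : Walk c b) →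
          (∀ {e} → e ∈ edges p → e ∈ es) → (∀ {e} → e ∈ edges r → e ∈ es) →
          (∀ {e} → e ∈ edges p → e ∈ fs) → (∀ {e} → e ∈ edges r → e ∈ fs) →
          ∃[ e ] (e ∈ es × e ∈ fs)
        build (step e _ _) _            p⊆es _    p⊆fs _    = e , p⊆es (here refl) , p⊆fs (here refl)
        build nil          (step e _ _) _    r⊆es _    r⊆fs = e , r⊆es (here refl) , r⊆fs (here refl)
        build nil          nil          _    _    _    _    = contradiction refl a≢c

      -- With fewer than three edges, either `a` and `c` coincide or `g` is parallel to an edge of
      -- `p` or `r`. In a simple graph it then equals that edge, although it lies off both.
      enough : ∀ {c} (p : Walk b a) (d : Walk x c) (r : Walk c b) → a ≢ c →
        g ∉ edges p → g ∉ edges r → 3 ℕ.≤ length (edges p ++ g ∷ edges d ++ edges r)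
      enough nil nil nil a≢c _ _ = contradiction refl a≢c
      enough nil nil (step e k nil) _ _ g∉r =
        contradiction (here (Joins-unique j (Joins-sym k))) g∉r
      enough nil nil (step _ _ (step _ _ _)) _ _ _ = s≤s (s≤s (s≤s z≤n))
      enough nil (step _ _ nil) nil a≢c _ _ = contradiction refl a≢c
      enough nil (step _ _ nil) (step _ _ _) _ _ _ = s≤s (s≤s (s≤s z≤n))
      enough nil (step _ _ (step _ _ _)) _ _ _ _ = s≤s (s≤s (s≤s z≤n))
      enough (step _ k nil) nil nil _ g∉p _ =
        contradiction (here (Joins-unique (Joins-sym j) k)) g∉p
      enough (step _ _ nil) nil (step _ _ _) _ _ _ = s≤s (s≤s (s≤s z≤n))
      enough (step _ _ nil) (step _ _ _) _ _ _ _ = s≤s (s≤s (s≤s z≤n))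
      enough (step _ _ (step _ _ p)) d r _ _ _ = s≤s (s≤s (nonempty (edges p)))
        where
        nonempty : ∀ (es : List Edge) {e fs} → 1 ℕ.≤ length (es ++ e ∷ fs)
        nonempty []      = s≤s z≤n
        nonempty (_ ∷ _) = s≤s z≤n

      C = record { walk = p · q · r ; distinct = uniq ; length≥3 = long }
      D = record { walk = newWalk ; distinct = new-unique
                 ; length≥3 = subst (λ es → 3 ℕ.≤ length es) (sym edges-new)
                     (enough p d r a≢c (g∉C ∘ old∋p) (g∉C ∘ old∋r)) }

    -- The base breaks the rotational symmetry of a cycle, so of two vertices on it either may come
    -- first.
    data Ordered {b} (C : Walk b b) (a c : Vertex) : Set where
      ordered : (p : Walk b a) (q : Walk a c) (r : Walk c b) → C ≡ p · q · r → Ordered C a c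

    order : ∀ {b a c} (C : Walk b b) → a ∈ sources C → c ∈ sources C → Ordered C a c ⊎ Ordered C c a
    order C a∈C c∈C with splitAtSource C a∈C
    ... | p , q , refl with ∈-++⁻ (sources p) (subst (_ ∈_) (sources-· p q) c∈C)
    ... | inj₁ c∈p with p₁ , p₂ , refl ← splitAtSource p c∈p =
      inj₂ (ordered p₁ p₂ q (·-assoc p₁ p₂ q))
    ... | inj₂ c∈q with q₁ , q₂ , refl ← splitAtSource q c∈q = inj₁ (ordered p q₁ q₂ refl)

    module _ (C : Cycle) where
      open Cycle C

      -- A chord missing from the cycle would be a detour consisting of `g` alone, with `d` empty.
      no-chord : ∀ {a c g} → a ∈ sources walk → c ∈ sources walk → Joins g a c → g ∈ edges walk
      no-chord {a} {c} {g} a∈C c∈C j =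
        decidable-stable (Dec∈._∈?_ Fin._≟_ g (edges walk)) λ g∉C → case order walk a∈C c∈C of λ where
          (inj₁ (ordered p q r eq)) → absurd p q r eq (Joins⇒≢ j) j g∉C
          (inj₂ (ordered p q r eq)) → absurd p q r eq (Joins⇒≢ j ∘ sym) (Joins-sym j) g∉C
        where
        absurd : ∀ {a c} (p : Walk base a) (q : Walk a c) (r : Walk c base) → walk ≡ p · q · r →
          a ≢ c → Joins g a c → g ∉ edges walk → ⊥
        absurd p q r eq a≢c j g∉C = detour-impossible p q r
          (subst (Unique ∘ sources) eq distinct) (subst (λ w → 3 ℕ.≤ length (edges w)) eq length≥3)
          a≢c j (g∉C ∘ subst (λ w → g ∈ edges w) (sym eq)) nil [] λ ()

      -- The linking walk, freed of loops and extended by `h`, is a detour whose inner vertices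
      -- avoid `S` and hence the cycle. If `c` comes before `a` the ear is traversed backwards, so
      -- that `h` becomes the first edge of the detour.
      no-ear : ∀ {S a c x y g h} → (∀ {t} → t ∈ sources walk → t ∈ˢ S) →
        a ∈ sources walk → c ∈ sources walk →
        Joins g a x → Linked S x y → Joins h y c → g ∉ edges walk → h ∉ edges walk → a ≡ c
      no-ear {S} {a} {c} C⊆S a∈C c∈C j linked k g∉C h∉C =
        decidable-stable (a Fin.≟ c) λ a≢c → case order walk a∈C c∈C of λ where
          (inj₁ (ordered p q r eq)) → absurd p q r eq a≢c j linked k g∉C
          (inj₂ (ordered p q r eq)) →
            absurd p q r eq (a≢c ∘ sym) (Joins-sym k) (Linked-sym linked) (Joins-sym j) h∉C
        where
        absurd : ∀ {a c x y g h} (p : Walk base a) (q : Walk a c) (r : Walk c base) →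
          walk ≡ p · q · r → a ≢ c → Joins g a x → Linked S x y → Joins h y c → g ∉ edges walk → ⊥
        absurd {g = g} p q r eq a≢c j (l , out) k g∉C with d , ud , d⊆l ← eraseLoops l =
          detour-impossible p q r
            (subst (Unique ∘ sources) eq distinct)
            (subst (λ w → 3 ℕ.≤ length (edges w)) eq length≥3)
            a≢c j (g∉C ∘ subst (λ w → g ∈ edges w) (sym eq)) (d · step _ k nil)
            (subst Unique (sym (sources-snoc d k)) ud)
            λ {t} t∈d t∈C → out (d⊆l (subst (t ∈_) (sources-snoc d k) t∈d))
                          (C⊆S (subst (λ w → t ∈ sources w) (sym eq) t∈C))

-- Growing the coloured set

insertAll : ∀ {n} → List (Fin n) → Subset n → Subset n
insertAll us S = foldr (λ u T → ⁅ u ⁆ ∪ T) S us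

module _ {n} {S : Subset n} where

  insertAll-⊇ : ∀ us → S ⊆ˢ insertAll us S
  insertAll-⊇ []       u∈S = u∈S
  insertAll-⊇ (u ∷ us) v∈S = x∈p∪q⁺ (inj₂ (insertAll-⊇ us v∈S))

  ∈-insertAll⁺ : ∀ {u} us → u ∈ us → u ∈ˢ insertAll us S
  ∈-insertAll⁺ (_ ∷ _)  (here refl) = x∈p∪q⁺ (inj₁ (x∈⁅x⁆ _))
  ∈-insertAll⁺ (_ ∷ us) (there u∈)  = x∈p∪q⁺ (inj₂ (∈-insertAll⁺ us u∈))

  ∈-insertAll⁻ : ∀ {u} us → u ∈ˢ insertAll us S → u ∈ us ⊎ u ∈ˢ S
  ∈-insertAll⁻ []       u∈S = inj₂ u∈S
  ∈-insertAll⁻ {u} (v ∷ vs) u∈ with x∈p∪q⁻ ⁅ v ⁆ (insertAll vs S) u∈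
  ... | inj₁ u∈v = inj₁ (here (x∈⁅y⁆⇒x≡y v u∈v))
  ... | inj₂ u∈′ with ∈-insertAll⁻ vs u∈′
  ... | inj₁ u∈vs = inj₁ (there u∈vs)
  ... | inj₂ u∈S  = inj₂ u∈S

module Colouring (G : Graph) (disjointCycles : Graph.EdgeDisjointCycles G)
  {n : ℕ} (bin : Graph.Vertex G → Graph.Edge G → Fin (2 + n)) where
  open Graph G
  open Walks G

  Colour Bin : Set
  Colour = Fin (3 + n)
  Bin    = Fin (2 + n)

  -- Surjectivity is what keeps a finished vertex extendable: whatever bin a later edge at it
  -- belongs to, some colour is sent there.
  Palette : Set
  Palette = Σ[ χ ∈ (Colour → Bin) ] (∀ b → ∃[ c ] χ c ≡ b)

  palette : ∀ {a c : Colour} → a ≢ c → (i k : Bin) → Palette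
  palette a≢c i k = let χ , onto , _ = prescribedSurjection a≢c i k in χ , onto

  serves-cong : ∀ {π π′ : Palette} {c c′ b} → π ≡ π′ → c ≡ c′ → proj₁ π′ c′ ≡ b → proj₁ π c ≡ b
  serves-cong refl refl eq = eq

  -- Every colour chosen on the way differs from that of the previous edge and from that of f,
  -- so at each vertex of p a palette serving both edges exists.
  colourPath : ∀ {x y e f} (p : Walk x y) (κ : Edge → Colour) (χ : Vertex → Palette) →
    Unique (vertices p) →
    (∀ {u v} → Joins e u v → u ∈ vertices p → u ≡ x) →
    (∀ {u v} → Joins f u v → u ∈ vertices p → u ≡ y) →
    κ e ≢ κ f ⊎ x ≢ y →
    Σ[ κ′ ∈ (Edge → Colour) ] Σ[ χ′ ∈ (Vertex → Palette) ]
      (∀ {g} → g ∉ edges p → κ′ g ≡ κ g) ×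
      (∀ {u} → u ∉ vertices p → χ′ u ≡ χ u) ×
      (∀ {g u v} → Joins g u v → u ∈ vertices p → g ∈ e ∷ f ∷ edges p →
        proj₁ (χ′ u) (κ′ g) ≡ bin u g)
  -- On a path without edges, `e` and `f` meet at its only vertex and need different colours. Once
  -- the path has an edge they may share a colour, because the first step puts a third colour
  -- between them.
  colourPath nil κ χ _ _ _ (inj₂ x≢x) = contradiction refl x≢x
  colourPath {x} {_} {e} {f} nil κ χ _ _ _ (inj₁ κe≢κf) =
    κ , updateAt χ x (const π) , (λ _ → refl) ,
    (λ {u} u∉ → updateAt-minimal u x χ λ { refl → u∉ (here refl) }) , served
    where
    π : Palette
    π = palette κe≢κf (bin x e) (bin x f)
    served : ∀ {g u v} → Joins g u v → u ∈ x ∷ [] → g ∈ e ∷ f ∷ [] →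
      proj₁ (updateAt χ x (const π) u) (κ g) ≡ bin u g
    served _ (here refl) g∈ rewrite updateAt-updates x {const π} χ with g∈
    ... | here refl         = proj₁ (proj₂ (proj₂ (prescribedSurjection κe≢κf (bin x e) (bin x f))))
    ... | there (here refl) = proj₂ (proj₂ (proj₂ (prescribedSurjection κe≢κf (bin x e) (bin x f))))
  colourPath {x} {y} {e} {f} (step {v = z} g j p) κ χ uniq@(_ ∷ uniq-p) e-outer f-outer _
    with t , κe≢t , t≢κf ← differentFromBoth (κ e) (κ f)
    with _ , onto , χe , χg ← prescribedSurjection κe≢t (bin x e) (bin x g) = result
    where
    x∉p : x ∉ vertices p
    x∉p = Unique.Unique[x∷xs]⇒x∉xs uniq

    z∈p : z ∈ vertices p
    z∈p = source∈vertices p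

    π : Palette
    π = _ , onto

    κ₁ : Edge → Colour
    κ₁ = updateAt κ g (const t)

    χ₁ : Vertex → Palette
    χ₁ = updateAt χ x (const π)

    e≢g : e ≢ g
    e≢g refl = Joins⇒≢ j (sym (e-outer (Joins-sym j) (there z∈p)))

    f≢g : f ≢ g
    f≢g refl = Joins⇒≢ j
      (≡.trans (f-outer j (here refl)) (sym (f-outer (Joins-sym j) (there z∈p))))

    g-outer : ∀ {u v} → Joins g u v → u ∈ vertices p → u ≡ z
    g-outer k u∈p with Joins-endpoints k j
    ... | inj₁ (refl , _) = contradiction u∈p x∉p
    ... | inj₂ (u≡z , _)  = u≡z

    κ₁g≢κ₁f : κ₁ g ≢ κ₁ f
    κ₁g≢κ₁f eq = t≢κf (≡.trans (sym (updateAt-updates g κ))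
      (≡.trans eq (updateAt-minimal f g κ f≢g)))

    result : Σ[ κ′ ∈ (Edge → Colour) ] Σ[ χ′ ∈ (Vertex → Palette) ]
      (∀ {h} → h ∉ g ∷ edges p → κ′ h ≡ κ h) ×
      (∀ {u} → u ∉ x ∷ vertices p → χ′ u ≡ χ u) ×
      (∀ {h u v} → Joins h u v → u ∈ x ∷ vertices p → h ∈ e ∷ f ∷ g ∷ edges p →
        proj₁ (χ′ u) (κ′ h) ≡ bin u h)
    -- On the rest of the path `g` takes over the role of the preceding edge `e`.
    result with colourPath p κ₁ χ₁ uniq-p g-outer (λ k → f-outer k ∘ there) (inj₁ κ₁g≢κ₁f)
    ... | κ₂ , χ₂ , κ₂-old , χ₂-old , served = κ₂ , χ₂ ,
      (λ {h} h∉ → ≡.trans (κ₂-old (h∉ ∘ there)) (updateAt-minimal h g κ λ { refl → h∉ (here refl) })) ,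
      (λ {u} u∉ → ≡.trans (χ₂-old (u∉ ∘ there)) (updateAt-minimal u x χ λ { refl → u∉ (here refl) })) ,
      served′
      where
      χ₂x : χ₂ x ≡ π
      χ₂x = ≡.trans (χ₂-old x∉p) (updateAt-updates x χ)

      served′ : ∀ {h u v} → Joins h u v → u ∈ x ∷ vertices p → h ∈ e ∷ f ∷ g ∷ edges p →
        proj₁ (χ₂ u) (κ₂ h) ≡ bin u h
      served′ k (here refl) (here refl) = serves-cong χ₂x
        (≡.trans (κ₂-old λ e∈p → x∉p (edge-endpoint p e∈p k)) (updateAt-minimal e g κ e≢g)) χe
      served′ k (here refl) (there (here refl)) =
        contradiction (subst (_∈ vertices p) (sym (f-outer k (here refl))) (target∈vertices p)) x∉p
      served′ k (here refl) (there (there (here refl))) = serves-cong χ₂x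
        (≡.trans (κ₂-old λ g∈p → x∉p (edge-endpoint p g∈p k)) (updateAt-updates g κ)) χg
      served′ k (here refl) (there (there (there h∈p))) = contradiction (edge-endpoint p h∈p k) x∉p
      served′ k (there u∈p) (here refl) =
        contradiction (subst (_∈ vertices p) (e-outer k (there u∈p)) u∈p) x∉p
      served′ k (there u∈p) (there (here refl))         = served k u∈p (there (here refl))
      served′ k (there u∈p) (there (there (here refl))) = served k u∈p (here refl)
      served′ k (there u∈p) (there (there (there h∈p))) = served k u∈p (there (there h∈p))

  -- Every component outside S is attached to S at no more than one vertex of S.
  Closed : Subset ∣V∣ → Set
  Closed S = ∀ {u u′ x y e f} → u ∈ˢ S → u′ ∈ˢ S →
    Joins e u x → Linked S x y → Joins f y u′ → u ≡ u′

  record Partial (S : Subset ∣V∣) : Set where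
    field
      colour   : Edge → Colour
      palettes : Vertex → Palette
      served   : ∀ {e u v} → Joins e u v → u ∈ˢ S → v ∈ˢ S →
                 proj₁ (palettes u) (colour e) ≡ bin u e
      closed   : Closed S

  module _ {S : Subset ∣V∣} (partial : Partial S) where
    open Partial partial

    module _ {v} (v∉S : v ∉ˢ S)
      (gateway : ∀ {f y u} → Joins f y u → u ∈ˢ S → Linked S v y → y ≡ v) where

      S+v : Subset ∣V∣
      S+v = insertAll [ v ] S

      ≢v : ∀ {s} → s ∈ˢ S → s ≢ v
      ≢v s∈S refl = v∉S s∈S

      -- In the mixed cases a component outside `S+v` touches both `v` and `S`. It then lies in the
      -- component of `v` outside `S`, and `gateway` forces its edge from `S` to end at `v` itself,
      -- which is no longer outside.
      closed+v : Closed S+v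
      closed+v {u} {u′} {x} {y} u∈ u′∈ j linked k
        with ∈-insertAll⁻ [ v ] u∈ | ∈-insertAll⁻ [ v ] u′∈ | Linked-weaken (insertAll-⊇ [ v ]) linked
      ... | inj₂ u∈S         | inj₂ u′∈S        | linked′ = closed u∈S u′∈S j linked′ k
      ... | inj₁ (here refl) | inj₁ (here refl) | _       = refl
      ... | inj₂ u∈S         | inj₁ (here refl) | linked′ = contradiction
        (gateway (Joins-sym j) u∈S
          (Linked-trans (Linked-edge (Joins-sym k) v∉S y∉S) (Linked-sym linked′)))
        x≢v
        where
        y∉S : y ∉ˢ S
        y∉S = proj₂ linked′ (target∈vertices (proj₁ linked′))
        x≢v : x ≢ v
        x≢v refl = proj₂ linked (source∈vertices (proj₁ linked)) (∈-insertAll⁺ [ v ] (here refl))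
      ... | inj₁ (here refl) | inj₂ u′∈S        | linked′ = contradiction
        (gateway k u′∈S (Linked-trans (Linked-edge j v∉S x∉S) linked′)) y≢v
        where
        x∉S : x ∉ˢ S
        x∉S = proj₂ linked′ (source∈vertices (proj₁ linked′))
        y≢v : y ≢ v
        y≢v refl = proj₂ linked (target∈vertices (proj₁ linked)) (∈-insertAll⁺ [ v ] (here refl))

      addVertex : Partial S+v
      addVertex with Fin.any? (λ e → Fin.any? λ u → Joins? e u v ×-dec (u ∈? S))
      ... | no none = record
        { colour = colour ; palettes = palettes ; served = served′ ; closed = closed+v }
        where
        served′ : ∀ {e s t} → Joins e s t → s ∈ˢ S+v → t ∈ˢ S+v →
          proj₁ (palettes s) (colour e) ≡ bin s e
        served′ j s∈ t∈ with ∈-insertAll⁻ [ v ] s∈ | ∈-insertAll⁻ [ v ] t∈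
        ... | inj₂ s∈S         | inj₂ t∈S         = served j s∈S t∈S
        ... | inj₂ s∈S         | inj₁ (here refl) = contradiction (_ , _ , j , s∈S) none
        ... | inj₁ (here refl) | inj₂ t∈S         = contradiction (_ , _ , Joins-sym j , t∈S) none
        ... | inj₁ (here refl) | inj₁ (here refl) = contradiction refl (Joins⇒≢ j)
      ... | yes (e , u , j , u∈S)
        with c , χc ← proj₂ (palettes u) (bin u e)
        -- A single edge constrains the surjection at `v`; `c′` fills the second prescription, with
        -- the same bin.
        with c′ , c≢c′ ← different c
        with _ , onto , χ-c , _ ← prescribedSurjection c≢c′ (bin v e) (bin v e) = record
        { colour   = updateAt colour e (const c)
        ; palettes = updateAt palettes v (const (_ , onto))
        ; served   = served′
        ; closed   = closed+v }
        where
        -- By `closed` with the trivial walk at `v`, all edges from `v` into `S` end at `u`, and a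
        -- simple graph has only one such edge.
        sole : ∀ {f s} → Joins f s v → s ∈ˢ S → f ≡ e
        sole k s∈S with refl ← closed s∈S u∈S k (Linked-refl v∉S) (Joins-sym j) = Joins-unique k j

        served′ : ∀ {f s t} → Joins f s t → s ∈ˢ S+v → t ∈ˢ S+v →
          proj₁ (updateAt palettes v (const (_ , onto)) s) (updateAt colour e (const c) f) ≡ bin s f
        served′ {f} {s} {t} k s∈ t∈ with ∈-insertAll⁻ [ v ] s∈ | ∈-insertAll⁻ [ v ] t∈
        ... | inj₁ (here refl) | inj₁ (here refl) = contradiction refl (Joins⇒≢ k)
        ... | inj₂ s∈S | inj₂ t∈S = serves-cong (updateAt-minimal s v palettes (≢v s∈S))
          (updateAt-minimal f e colour f≢e) (served k s∈S t∈S)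
          where
          f≢e : f ≢ e
          f≢e refl with Joins-endpoints k j
          ... | inj₁ (_ , refl) = v∉S t∈S
          ... | inj₂ (refl , _) = v∉S s∈S
        ... | inj₂ s∈S | inj₁ (here refl)
          with refl ← sole k s∈S | refl ← closed s∈S u∈S k (Linked-refl v∉S) (Joins-sym j) =
          serves-cong (updateAt-minimal s v palettes (≢v s∈S)) (updateAt-updates e colour) χc
        ... | inj₁ (here refl) | inj₂ t∈S
          with refl ← sole (Joins-sym k) t∈S =
          serves-cong (updateAt-updates v palettes) (updateAt-updates e colour) χ-c

    module _ {u v y e f} (u∈S : u ∈ˢ S) (j : Joins e u v) (p : Walk v y) (k : Joins f y u)
      (e≢f : e ≢ f) (uniq : Unique (vertices p)) (out : ∀ {t} → t ∈ vertices p → t ∉ˢ S) where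

      S+p : Subset ∣V∣
      S+p = insertAll (vertices p) S

      C : Cycle
      C = record
        { walk     = step e j (p · step f k nil)
        ; distinct = subst Unique (sym (cong (u ∷_) (sources-snoc p k)))
            (All.tabulate (λ { u∈p refl → out u∈p u∈S }) ∷ uniq)
        ; length≥3 = subst (λ es → 3 ℕ.≤ suc (length es)) (sym (edges-· p _)) (long p j k)
        }
        where
        long : ∀ {v} (p : Walk v y) → Joins e u v → Joins f y u → 3 ℕ.≤ suc (length (edges p ++ [ f ]))
        long nil                   j k = contradiction (Joins-unique j (Joins-sym k)) e≢f
        long (step _ _ nil)        j k = s≤s (s≤s (s≤s z≤n))
        long (step _ _ (step _ _ _)) j k = s≤s (s≤s (s≤s z≤n))

      ∈C : ∀ {t} → t ∈ u ∷ vertices p → t ∈ sources (Cycle.walk C)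
      ∈C {t} = subst (t ∈_) (sym (cong (u ∷_) (sources-snoc p k)))

      C⊆S+p : ∀ {t} → t ∈ sources (Cycle.walk C) → t ∈ˢ S+p
      C⊆S+p {t} t∈C with subst (t ∈_) (cong (u ∷_) (sources-snoc p k)) t∈C
      ... | here refl = insertAll-⊇ (vertices p) u∈S
      ... | there t∈p = ∈-insertAll⁺ (vertices p) t∈p

      C-edge⁻ : ∀ {g} → g ∈ edges (Cycle.walk C) → g ∈ e ∷ f ∷ edges p
      C-edge⁻ (here refl) = here refl
      C-edge⁻ {g} (there g∈) with ∈-++⁻ (edges p) (subst (g ∈_) (edges-· p _) g∈)
      ... | inj₁ g∈p         = there (there g∈p)
      ... | inj₂ (here refl) = there (here refl)

      C-endpoint : ∀ {g s t} → g ∈ edges (Cycle.walk C) → Joins g s t → s ∈ˢ S+p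
      C-endpoint g∈C l with C-edge⁻ g∈C
      ... | here refl with Joins-endpoints l j
      ...   | inj₁ (refl , _) = insertAll-⊇ (vertices p) u∈S
      ...   | inj₂ (refl , _) = ∈-insertAll⁺ (vertices p) (source∈vertices p)
      C-endpoint g∈C l | there (here refl) with Joins-endpoints l k
      ...   | inj₁ (refl , _) = ∈-insertAll⁺ (vertices p) (target∈vertices p)
      ...   | inj₂ (refl , _) = insertAll-⊇ (vertices p) u∈S
      C-endpoint g∈C l | there (there g∈p) = ∈-insertAll⁺ (vertices p) (edge-endpoint p g∈p l)

      linked-v : ∀ {t} → t ∈ vertices p → Linked S t v
      linked-v t∈p with splitAtVertex p t∈p
      ... | q , _ , q⊆p , _ = Linked-sym (q , out ∘ q⊆p)

      -- Two attachments on the cycle would make the component an ear. An attachment in `S` of a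
      -- component that also touches the path must be `u`, by the old invariant, so it is on the
      -- cycle as well.
      closed+p : Closed S+p
      closed+p {s} {t} {x} {x′} {g} {h} s∈ t∈ l linked l′ =
        case (∈-insertAll⁻ (vertices p) s∈ , ∈-insertAll⁻ (vertices p) t∈) of λ where
          (inj₂ s∈S , inj₂ t∈S) → closed s∈S t∈S l linked′ l′
          (inj₁ s∈p , inj₁ t∈p) → ear (there s∈p) (there t∈p)
          (inj₂ s∈S , inj₁ t∈p) → ear
            (here (closed s∈S u∈S l
              (Linked-trans linked′ (Linked-trans (Linked-edge l′ x′∉S (out t∈p)) (linked-v t∈p)))
              (Joins-sym j)))
            (there t∈p)
          (inj₁ s∈p , inj₂ t∈S) → ear (there s∈p)
            (here (closed t∈S u∈S (Joins-sym l′)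
              (Linked-trans (Linked-sym linked′)
                (Linked-trans (Linked-edge (Joins-sym l) x∉S (out s∈p)) (linked-v s∈p)))
              (Joins-sym j)))
        where
        linked′ : Linked S x x′
        linked′ = Linked-weaken (insertAll-⊇ (vertices p)) linked
        x∉S : x ∉ˢ S
        x∉S = proj₂ linked′ (source∈vertices (proj₁ linked′))
        x′∉S : x′ ∉ˢ S
        x′∉S = proj₂ linked′ (target∈vertices (proj₁ linked′))
        ear : s ∈ u ∷ vertices p → t ∈ u ∷ vertices p → s ≡ t
        ear s∈C t∈C = no-ear disjointCycles C C⊆S+p (∈C s∈C) (∈C t∈C) l linked l′
          (λ g∈C → proj₂ linked (source∈vertices (proj₁ linked)) (C-endpoint g∈C (Joins-sym l)))
          (λ h∈C → proj₂ linked (target∈vertices (proj₁ linked)) (C-endpoint h∈C l′))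

      addCycle : Partial S+p
      addCycle
        -- The palette of `u` is already fixed and dictates the colours of both `e` and `f`.
        with c , χc ← proj₂ (palettes u) (bin u e)
        with d , χd ← proj₂ (palettes u) (bin u f) = extended
        where
        κ₀ : Edge → Colour
        κ₀ = updateAt (updateAt colour e (const c)) f (const d)

        κ₀e : κ₀ e ≡ c
        κ₀e = ≡.trans (updateAt-minimal e f _ e≢f) (updateAt-updates e colour)

        κ₀f : κ₀ f ≡ d
        κ₀f = updateAt-updates f (updateAt colour e (const c))

        κ₀-old : ∀ {g} → g ≢ e → g ≢ f → κ₀ g ≡ colour g
        κ₀-old {g} g≢e g≢f = ≡.trans (updateAt-minimal g f _ g≢f) (updateAt-minimal g e colour g≢e)

        u∉p : u ∉ vertices p
        u∉p u∈p = out u∈p u∈S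

        e-outer : ∀ {s t} → Joins e s t → s ∈ vertices p → s ≡ v
        e-outer l s∈p with Joins-endpoints l j
        ... | inj₁ (refl , _) = contradiction s∈p u∉p
        ... | inj₂ (s≡v , _)  = s≡v

        f-outer : ∀ {s t} → Joins f s t → s ∈ vertices p → s ≡ y
        f-outer l s∈p with Joins-endpoints l k
        ... | inj₁ (s≡y , _)  = s≡y
        ... | inj₂ (refl , _) = contradiction s∈p u∉p

        -- `u` may dictate the same colour for `e` and `f`, so `colourPath` is started from the fact
        -- that the path has an edge.
        v≢y : v ≢ y
        v≢y refl = e≢f (Joins-unique j (Joins-sym k))

        extended : Partial S+p
        extended with colourPath p κ₀ palettes uniq e-outer f-outer (inj₂ v≢y)
        ... | κ , χ , κ-old , χ-old , served-p = record
          { colour = κ ; palettes = χ ; served = served′ ; closed = closed+p }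
          where
          κ-off-p : ∀ {g s t} → Joins g s t → s ∈ˢ S → κ g ≡ κ₀ g
          κ-off-p l s∈S = κ-old λ g∈p → out (edge-endpoint p g∈p l) s∈S

          χ-S : ∀ {s} → s ∈ˢ S → χ s ≡ palettes s
          χ-S s∈S = χ-old λ s∈p → out s∈p s∈S

          chord : ∀ {g s t} → Joins g s t → s ∈ u ∷ vertices p → t ∈ u ∷ vertices p → g ∈ e ∷ f ∷ edges p
          chord l s∈C t∈C = C-edge⁻ (no-chord disjointCycles C (∈C s∈C) (∈C t∈C) l)

          atBase : ∀ {g t} → Joins g u t → g ∈ e ∷ f ∷ edges p → proj₁ (palettes u) (κ g) ≡ bin u g
          atBase l (here refl) =
            ≡.trans (cong (proj₁ (palettes u)) (≡.trans (κ-off-p l u∈S) κ₀e)) χc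
          atBase l (there (here refl)) =
            ≡.trans (cong (proj₁ (palettes u)) (≡.trans (κ-off-p l u∈S) κ₀f)) χd
          atBase l (there (there g∈p)) = contradiction (edge-endpoint p g∈p l) u∉p

          served′ : ∀ {g s t} → Joins g s t → s ∈ˢ S+p → t ∈ˢ S+p → proj₁ (χ s) (κ g) ≡ bin s g
          served′ {g} {s} {t} l s∈ t∈
            with ∈-insertAll⁻ (vertices p) s∈ | ∈-insertAll⁻ (vertices p) t∈
          ... | inj₁ s∈p | inj₁ t∈p = served-p l s∈p (chord l (there s∈p) (there t∈p))
          -- The old invariant makes `u` the only vertex of `S` adjacent to the path, so the edge
          -- joins two vertices of the cycle and belongs to it.
          ... | inj₁ s∈p | inj₂ t∈S = served-p l s∈p (chord l (there s∈p)
            (here (closed t∈S u∈S (Joins-sym l) (linked-v s∈p) (Joins-sym j))))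
          ... | inj₂ s∈S | inj₁ t∈p
            with refl ← closed s∈S u∈S l (linked-v t∈p) (Joins-sym j) =
            serves-cong (χ-S s∈S) refl (atBase l (chord l (here refl) (there t∈p)))
          ... | inj₂ s∈S | inj₂ t∈S = serves-cong (χ-S s∈S)
            (≡.trans (κ-off-p l s∈S) (κ₀-old g≢e g≢f)) (served l s∈S t∈S)
            where
            g≢e : g ≢ e
            g≢e refl with Joins-endpoints l j
            ... | inj₁ (_ , refl) = out (source∈vertices p) t∈S
            ... | inj₂ (refl , _) = out (source∈vertices p) s∈S
            g≢f : g ≢ f
            g≢f refl with Joins-endpoints l k
            ... | inj₁ (refl , _) = out (target∈vertices p) s∈S
            ... | inj₂ (_ , refl) = out (target∈vertices p) t∈S

  BinRespecting : Set
  BinRespecting = Σ[ κ ∈ (Edge → Colour) ] Σ[ χ ∈ (Vertex → Colour → Bin) ]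
    (∀ {e u v} → Joins e u v → χ u (κ e) ≡ bin u e)

  -- If no edge leaves `S`, any outside vertex starts a new component. Otherwise some `e` leaves `S`
  -- at `u`, and a second edge between `S` and the component of `v` decides between closing a cycle
  -- and adding `v` alone. Each round enlarges `S`.
  complete : ∀ S → Acc _⊃_ S → Partial S → BinRespecting
  complete S (acc rec) partial
    with Fin.any? (λ e → Fin.any? λ u → Fin.any? λ v → Joins? e u v ×-dec (u ∈? S) ×-dec ¬? (v ∈? S))
  ... | no none with Fin.any? (λ v → ¬? (v ∈? S))
  ...   | yes (v , v∉S) = complete _ (rec grow)
          (addVertex partial v∉S λ k u∈S (l , out) →
            contradiction (_ , _ , _ , Joins-sym k , u∈S , out (target∈vertices l)) none)
    where
    grow : insertAll [ v ] S ⊃ S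
    grow = insertAll-⊇ [ v ] , v , ∈-insertAll⁺ [ v ] (here refl) , v∉S
  ...   | no full = colour , proj₁ ∘ palettes , λ j → served j (all _) (all _)
    where
    open Partial partial
    all : ∀ v → v ∈ˢ S
    all v = decidable-stable (v ∈? S) λ v∉S → full (v , v∉S)
  complete S (acc rec) partial | yes (e , u , v , j , u∈S , v∉S)
    with Fin.any? (λ f → Fin.any? λ y → Fin.any? λ u′ →
      ¬? (e Fin.≟ f) ×-dec Joins? f y u′ ×-dec (u′ ∈? S) ×-dec linked? S (acc rec) v y)
  ... | yes (f , y , u′ , e≢f , k , u′∈S , linked)
    -- The invariant identifies the two attachments, so a simple path from `v` to `y` closes up to a
    -- cycle through `u`.
    with refl ← Partial.closed partial u∈S u′∈S j linked k
    with p , uniq , p⊆l ← eraseLoops (proj₁ linked) = complete _ (rec grow)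
      (addCycle partial u∈S j p k e≢f uniq (proj₂ linked ∘ p⊆l))
    where
    grow : insertAll (vertices p) S ⊃ S
    grow = insertAll-⊇ (vertices p) , v , ∈-insertAll⁺ (vertices p) (source∈vertices p) , v∉S
  ... | no none = complete _ (rec grow) (addVertex partial v∉S gateway)
    where
    grow : insertAll [ v ] S ⊃ S
    grow = insertAll-⊇ [ v ] , v , ∈-insertAll⁺ [ v ] (here refl) , v∉S
    -- The search found no second edge from `S` into the component of `v`, so the edge is `e`, whose
    -- end outside `S` is `v`.
    gateway : ∀ {f y u′} → Joins f y u′ → u′ ∈ˢ S → Linked S v y → y ≡ v
    gateway {f} k u′∈S linked with e Fin.≟ f
    ... | no e≢f = contradiction (f , _ , _ , e≢f , k , u′∈S , linked) none
    ... | yes refl with Joins-endpoints k j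
    ...   | inj₁ (refl , refl) = contradiction u∈S (proj₂ linked (target∈vertices (proj₁ linked)))
    ...   | inj₂ (y≡v , _)     = y≡v

  binRespecting : BinRespecting
  binRespecting = complete ∅ (⊃-wellFounded ∅) record
    { colour   = const zero
    ; palettes = const (palette {zero} {suc zero} (λ ()) zero zero)
    ; served   = λ _ u∈∅ → contradiction u∈∅ ∉⊥
    ; closed   = λ u∈∅ → contradiction u∈∅ ∉⊥
    }

-- From packings to colour classes

-- Indices past the end of the list name empty bins, which pads a packing to any length.
slot : {A : Set} → List (List A) → ℕ → List A
slot []           _       = []
slot (bin ∷ _)    zero    = bin
slot (_   ∷ bins) (suc i) = slot bins i

module _ {A : Set} where

  slot-All : ∀ {P : List A → Set} {bins} → P [] → All P bins → ∀ i → P (slot bins i)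
  slot-All p[] []       _       = p[]
  slot-All p[] (p ∷ _)  zero    = p
  slot-All p[] (_ ∷ ps) (suc i) = slot-All p[] ps i

  slot-Any : ∀ {P : List A → Set} {bins} → Any P bins →
    ∃[ i ] (i ℕ.< length bins × P (slot bins i))
  slot-Any (here p)  = 0 , s≤s z≤n , p
  slot-Any (there p) = let i , i< , q = slot-Any p in suc i , s≤s i< , q

  -- Gives all vertices the same number `m` of bins, so that one set of `m + 1` colours can be
  -- mapped onto the bins of each.
  Slots : (A → ℝ) → List A → ℕ → Set
  Slots w items m = Σ[ bin ∈ (Fin m → List A) ]
    (∀ b → weight w (bin b) ≤ℝ 1ℝ) × (∀ {x} → x ∈ items → ∃[ b ] x ∈ bin b)

  minBins⇒slots : ∀ {w items k m} → IsMinBins w items k → k ℕ.≤ m → Slots w items m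
  minBins⇒slots {w} {items} {m = m} ((bins , (concat↭ , fit) , refl) , _) k≤m =
    slot bins ∘ Fin.toℕ ,
    (slot-All {λ bin → weight w bin ≤ℝ 1ℝ} 0≲1 fit ∘ Fin.toℕ) ,
    λ x∈ → let i , i<k , x∈bin = slot-Any (∈-concat⁻ bins (∈-resp-↭ (↭-sym concat↭) x∈))
               i<m = ℕ.<-≤-trans i<k k≤m
           in Fin.fromℕ< i<m , subst (λ j → _ ∈ slot bins j) (sym (Fin.toℕ-fromℕ< i<m)) x∈bin

minBins≤maximum : ∀ {n} (b : Fin n → ℕ) v → b v ℕ.≤ maximum b
minBins≤maximum b v = All.lookup (xs≤max 0 _) (∈-map⁺ b (∈-allFin v))

open import Defs

module _ (G : Graph) (disjointCycles : EdgeDisjointCycles G) (w : Edge G → ℝ) where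

  ClassesFit : ∀ {k} → (Edge G → Fin k) → Set
  ClassesFit color = ∀ v c →
    ∃[ bin ] (weight w bin ≤ℝ 1ℝ × (∀ {e} → e ∈ colorClass G color v c → e ∈ bin))

  module _ {n} (slots : ∀ v → Slots w (incidentEdges G v) (2 + n)) where

    slotOf : ∀ v e → ∃[ b ] (Incident G v e → e ∈ proj₁ (slots v) b)
    slotOf v e = decide (incident? G v e) λ v∼e →
      proj₂ (proj₂ (slots v)) (∈-filter⁺ (incident? G v) (∈-allFin e) v∼e)
      where
      decide : ∀ {P : Set} {Q : Fin (2 + n) → Set} → Dec P → (P → ∃[ b ] Q b) → ∃[ b ] (P → Q b)
      decide (yes p) find = let b , q = find p in b , const q
      -- A vertex and an edge that are not incident get the default bin `zero`.
      decide (no ¬p) find = zero , λ p → contradiction p ¬p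

    open Colouring G disjointCycles (λ v e → proj₁ (slotOf v e))

    binRespecting⇒fits : BinRespecting →
      Σ[ color ∈ (Edge G → Fin (3 + n)) ] ClassesFit color
    binRespecting⇒fits (κ , χ , respects) = κ , λ v c →
      let bin , fits , _ = slots v in bin (χ v c) , fits (χ v c) , inBin
      where
      respects′ : ∀ {v e} → Incident G v e → χ v (κ e) ≡ proj₁ (slotOf v e)
      respects′ (inj₁ refl) = respects (inj₁ refl)
      respects′ (inj₂ refl) = respects (inj₂ refl)

      inBin : ∀ {v c e} → e ∈ colorClass G κ v c → e ∈ proj₁ (slots v) (χ v c)
      inBin {v} {c} {e} e∈class =
        subst (λ b → e ∈ proj₁ (slots v) b)
          (≡.trans (sym (respects′ v∼e)) (cong (χ v) κe≡c))
          (proj₂ (slotOf v e) v∼e)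
        where
        κe≡c : κ e ≡ c
        κe≡c = proj₂ (∈-filter⁻ (λ f → κ f Fin.≟ c) {xs = incidentEdges G v} e∈class)
        v∼e : Incident G v e
        v∼e = proj₂ (∈-filter⁻ (incident? G v) {xs = allFin (∣E∣ G)}
          (proj₁ (∈-filter⁻ (λ f → κ f Fin.≟ c) e∈class)))

  colorWithSlots : ∀ m (slots : ∀ v → Slots w (incidentEdges G v) m) →
    Σ[ color ∈ (Edge G → Fin (suc m)) ] ClassesFit color
  -- Without bins there are no incident edges, so every class is empty.
  colorWithSlots zero slots = const zero , λ v c → [] , 0≲1 ,
    λ e∈class → case proj₂ (proj₂ (slots v)) (proj₁ (∈-filter⁻ _ e∈class)) of λ ()
  colorWithSlots (suc zero) slots = const zero , λ v c →
    let bin , fits , find = slots v in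
    bin zero , fits zero , λ e∈class → case find (proj₁ (∈-filter⁻ _ e∈class)) of λ where
      (zero , e∈) → e∈
  colorWithSlots (suc (suc n)) slots =
    binRespecting⇒fits slots (Colouring.binRespecting G disjointCycles _)

theorem10 : (G : Graph) →
    EdgeDisjointCycles G →
    (w : Edge G → ℝ) →
    (∀ e → (0ℝ ≤ℝ w e) × (w e ≤ℝ 1ℝ)) →
    (minBins : Vertex G → ℕ) →
    (∀ v → IsMinBins w (incidentEdges G v) (minBins v)) →
    (m : ℕ) → m ≡ maximum minBins →
    Σ[ color ∈ (Edge G → Fin (m + 1)) ] IsProperWeightedColoring G w color
theorem10 G disjointCycles w bounds minBins isMin m refl =
  subst (λ k → Σ[ color ∈ (Edge G → Fin k) ] IsProperWeightedColoring G w color) (ℕ.+-comm 1 m)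
    (color , λ v c → let bin , fits , class⊆bin = covered v c in
      weight≤1-⊆ w (proj₁ ∘ bounds)
        -- A colour class is filtered twice from the enumeration of all edges and so has no
        -- repetitions.
        (Unique.filter⁺ _ (Unique.filter⁺ (incident? G v) (Unique.allFin⁺ (∣E∣ G)))) class⊆bin fits)
  where
  slots : ∀ v → Slots w (incidentEdges G v) m
  slots v = minBins⇒slots (isMin v) (minBins≤maximum minBins v)
  color : Edge G → Fin (suc m)
  color = proj₁ (colorWithSlots G disjointCycles w m slots)
  covered : ClassesFit G disjointCycles w color
  covered = proj₂ (colorWithSlots G disjointCycles w m slots)
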